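{- Let $N\in\{2,3,\dots\}$, let $p_1,\dots,p_N\in(0,1)$ be such that $m\neq n\Rightarrow p_m\neq p_n$, and let $\sigma$ be any admissible stationary strategy profile, with shooting probabilities $x_{\mathbf{s},n}$. Then the $N$-uel payoff system has a unique solution; i.e., for each $i\in\{1,\dots,N\}$ there is exactly one family of real numbers $(V_{i,\mathbf{s}})_{\mathbf{s}\in S}$ satisfying the payoff equations of player $P_i$.
   Context: The $N$-uel is a turn-based game with players $P_1,\dots,P_N$. A state is $\mathbf{s}=s_0s_1\dots s_N$, where for $j\ge1$, $s_j=1$ (resp. $0$) means $P_j$ is alive (resp. dead), and $s_0$ is the index of the player who has the move ($s_0=0$ if the game is over). The set of admissible states is $S=\bigcup_{k=1}^N S_k$, where $S_1$ is the set of terminal states $0s_1\dots s_N$ with exactly one $s_j=1$ ($j\ge 1$), and, for $k\in\{2,\dots,N\}$, $S_k=\{s_0s_1\dots s_N: s_0\neq0,\ s_{s_0}=1,\ \sum_{j=1}^N s_j=k\}$. At each turn the player $P_m$ having the move must shoot at an alive player other than himself, and kills his target with probability $p_m$ (his marksmanship); the move then passes to the next surviving player in the cyclic order $1\to2\to\dots\to N\to1$. The last surviving player wins. Notation: for a nonterminal state $\mathbf{s}=ms_1\dots s_N$, let $L(\mathbf{s})=\{n:s_n=1\}$ and $L_m(\mathbf{s})=L(\mathbf{s})\setminus\{m\}$; let $\mathbf{N}(\mathbf{s})$ be the state following $\mathbf{s}$ when nobody is killed (same alive players, the move passes to the next alive player after $m$ in cyclic order); and for $n\in L_m(\mathbf{s})$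 let $\mathbf{N}_n(\mathbf{s})$ be the state following $\mathbf{s}$ when $P_n$ is killed ($s_n$ is set to $0$ and the move passes to the next surviving player after $m$ in cyclic order, or $s_0$ becomes $0$ if only $P_m$ survives). An admissible stationary strategy profile $\sigma$ is given by the probabilities $x_{\mathbf{s},n}\ge0$ that the player $P_m$ having the move at the nonterminal state $\mathbf{s}=ms_1\dots s_N$ shoots at $P_n$, where $x_{\mathbf{s},n}=0$ for $n\notin L_m(\mathbf{s})$ and $\sum_{n\in L_m(\mathbf{s})}x_{\mathbf{s},n}=1$. The payoff equations of $P_i$, in the unknowns $(V_{i,\mathbf{s}})_{\mathbf{s}\in S}$ ($V_{i,\mathbf{s}}$ being the expected payoff of $P_i$, i.e. his winning probability, when the game starts at $\mathbf{s}$), are: 1. For terminal states $\mathbf{s}=0s_1\dots s_N\in S_1$: $V_{i,\mathbf{s}}=1$ if $s_i=1$ and $V_{i,\mathbf{s}}=0$ if $s_i=0$. 2. For $\mathbf{s}\in S_2$ with alive players $P_i$ and $P_m$: $V_{i,is_1\dots s_N}=\dfrac{p_i}{p_i+p_m-p_ip_m}$ (when $P_i$ has the move) and $V_{i,ms_1\dots s_N}=\dfrac{p_i(1-p_m)}{p_i+p_m-p_ip_m}$ (when $P_m$ has the move). 3. For $\mathbf{s}\in S_2$ with two alive players both different from $P_i$: $V_{i,\mathbf{s}}=0$. 4. For $k\in\{3,\dots,N\}$ and $\mathbf{s}=ms_1\dots s_N\in S_k$: if $i\in L(\mathbf{s})$, then $$V_{i,\mathbf{s}}=(1-p_m)V_{i,\mathbf{N}(\mathbf{s})}+\sum_{n\in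 L_m(\mathbf{s})}x_{\mathbf{s},n}\,p_m\,V_{i,\mathbf{N}_n(\mathbf{s})},$$ and if $i\notin L(\mathbf{s})$, then $V_{i,\mathbf{s}}=0$. The $N$-uel payoff system consists of these equations for all $i\in\{1,\dots,N\}$. -}

module Defs where

open import Level using (_⊔_)
open import Algebra.Apartness.Bundles using (HeytingCommutativeRing; HeytingField)
open import Algebra.Bundles using (CommutativeRing)
import Algebra.Definitions.RawMonoid as RawMonoidDefinitions
import Algebra.Properties.CommutativeMonoid.Sum as Summation
import Algebra.Properties.Ring as RingProperties
open import Data.Fin.Base using (Fin; zero; suc)
open import Data.Fin.Subset using (Subset; inside; outside; _∈_; _∉_; ∣_∣)
  renaming (_-_ to _∖_)
open import Data.Fin.Subset.Properties using (_∈?_; x∈p∧x≢y⇒x∈p-y)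
open import Data.Maybe.Base using (Maybe; just; nothing; fromMaybe; _<∣>_)
import Data.Maybe.Base as Maybe
open import Data.Nat.Base as ℕ using (ℕ; zero; suc; z≤n; s≤s)
import Data.Nat.Properties as ℕ
open import Data.Product.Base using (_×_; _,_; proj₁; ∃-syntax)
open import Data.Sum.Base using (_⊎_; inj₂)
open import Data.Vec.Base using ([]; _∷_; here; there)
open import Function.Base using (_∘_)
open import Function.Bundles using (_⇔_; Equivalence)
open import Relation.Binary.Core using (Rel)
open import Relation.Binary.PropositionalEquality as ≡ using (_≡_; _≢_)
open import Relation.Binary.Structures using (IsStrictPartialOrder)
open import Relation.Nullary using (¬_; Dec; yes; no)

-- The real numbers, given axiomatically as a Cauchy-complete Archimedean
-- ordered field.  Since the logic is constructive, "field" means Heyting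
-- field, and apartness x # y (a positive distance) means x < y or y < x;
-- under excluded middle x # y is ¬ (x ≈ y), and these are the usual axioms of ℝ.

record RealNumbers c ℓ₁ ℓ₂ : Set (Level.suc (c ⊔ ℓ₁ ⊔ ℓ₂)) where
  infix 4 _<_ _≤_

  field
    heytingField : HeytingField c ℓ₁ ℓ₂

  open HeytingField heytingField public
  open HeytingCommutativeRing heytingCommutativeRing public using (commutativeRing)
  open CommutativeRing commutativeRing public
    using (ring; +-rawMonoid; +-commutativeMonoid)

  field
    _<_                  : Rel Carrier ℓ₂
    isStrictPartialOrder : IsStrictPartialOrder _≈_ _<_
    #⇔<⊎>                : ∀ {x y} → x # y ⇔ (x < y ⊎ y < x)
    +-monoˡ-<            : ∀ {x y} z → x < y → x + z < y + z
    *-pos                : ∀ {x y} → 0# < x → 0# < y → 0# < x * y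

  open RawMonoidDefinitions +-rawMonoid public using () renaming (_×_ to _·_)

  IsCauchy : (ℕ → Carrier) → Set (c ⊔ ℓ₂)
  IsCauchy a = ∀ ε → 0# < ε →
    ∃[ k ] ∀ m n → k ℕ.≤ m → k ℕ.≤ n → a m - a n < ε

  _ConvergesTo_ : (ℕ → Carrier) → Carrier → Set (c ⊔ ℓ₂)
  a ConvergesTo l = ∀ ε → 0# < ε →
    ∃[ k ] ∀ n → k ℕ.≤ n → (a n - l < ε) × (l - a n < ε)

  field
    archimedean : ∀ x → ∃[ n ] x < n · 1#
    complete    : ∀ a → IsCauchy a → ∃[ l ] a ConvergesTo l

  open IsStrictPartialOrder isStrictPartialOrder public
    using (<-respʳ-≈; <-respˡ-≈)
    renaming (irrefl to <-irrefl; trans to <-trans)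

  _≤_ : Rel Carrier ℓ₂
  x ≤ y = ¬ (y < x)

  -- The library's #⇒invertible inverts x - 0# rather than x.
  _/_[_] : (x y : Carrier) → y # 0# → Carrier
  x / y [ y#0 ] = x * proj₁ (#⇒invertible y#0)

  valueIf : ∀ {P : Set} → Dec P → (P → Carrier) → Carrier
  valueIf (yes h) g = g h
  valueIf (no  _) g = 0#

  ∑∈ : ∀ {n} (A : Subset n) → ((j : Fin n) → j ∈ A → Carrier) → Carrier
  ∑∈ A f = Summation.sum +-commutativeMonoid (λ j → valueIf (j ∈? A) (f j))

  0<x⇒x#0 : ∀ {x} → 0# < x → x # 0#
  0<x⇒x#0 = Equivalence.from #⇔<⊎> ∘ inj₂

  0<x+y : ∀ {x y} → 0# < x → 0# < y → 0# < x + y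
  0<x+y {x} {y} 0<x 0<y =
    <-trans 0<y (<-respˡ-≈ (+-identityˡ y) (+-monoˡ-< y 0<x))

  x<y⇒0<y-x : ∀ {x y} → x < y → 0# < y - x
  x<y⇒0<y-x {x} x<y = <-respˡ-≈ (-‿inverseʳ x) (+-monoˡ-< (- x) x<y)

  0<x+y-xy : ∀ {x y} → 0# < x → x < 1# → 0# < y → 0# < x + y - x * y
  0<x+y-xy {x} {y} 0<x x<1 0<y =
    <-respʳ-≈ eq (0<x+y 0<x (*-pos (x<y⇒0<y-x x<1) 0<y))
    where
    eq : x + (1# - x) * y ≈ x + y - x * y
    eq = trans
      (+-congˡ (trans (RingProperties.[y-z]x≈yx-zx ring y 1# x)
                      (+-congʳ (*-identityˡ y))))
      (sym (+-assoc x y (- (x * y))))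

-- Players P₁,…,P_N are represented by Fin N (so P₁ is zero), and a set of alive
-- players by a Subset N.

first : ∀ {n} → Subset n → Maybe (Fin n)
first []            = nothing
first (inside  ∷ A) = just zero
first (outside ∷ A) = Maybe.map suc (first A)

firstAfter : ∀ {n} → Subset n → Fin n → Maybe (Fin n)
firstAfter (_ ∷ A) zero    = Maybe.map suc (first A)
firstAfter (_ ∷ A) (suc m) = Maybe.map suc (firstAfter A m)

-- The next element of A after m in the cyclic order: the least element greater
-- than m, or else the least element.  The default m is only reached for empty A.
next : ∀ {n} → Subset n → Fin n → Fin n
next A m = fromMaybe m (firstAfter A m <∣> first A)

first-∈ : ∀ {n} (A : Subset n) {j} → first A ≡ just j → j ∈ A
first-∈ (inside  ∷ A) ≡.refl = here
first-∈ (outside ∷ A) eq with just k ← first A in eq′ | ≡.refl ← eq =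
  there (first-∈ A eq′)

firstAfter-∈ : ∀ {n} (A : Subset n) m {j} → firstAfter A m ≡ just j → j ∈ A
firstAfter-∈ (_ ∷ A) zero    eq with just k ← first A in eq′ | ≡.refl ← eq =
  there (first-∈ A eq′)
firstAfter-∈ (_ ∷ A) (suc m) eq with just k ← firstAfter A m in eq′ | ≡.refl ← eq =
  there (firstAfter-∈ A m eq′)

next-∈ : ∀ {n} (A : Subset n) m → m ∈ A → next A m ∈ A
next-∈ A m m∈A with firstAfter A m in eq | first A in eq′
... | just _  | _       = firstAfter-∈ A m eq
... | nothing | just _  = first-∈ A eq′
... | nothing | nothing = m∈A

j∉A∖j : ∀ {n} (A : Subset n) j → j ∉ A ∖ j
j∉A∖j (_ ∷ A) (suc j) (there h) = j∉A∖j A j h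

j∈A⇒1≤∣A∣ : ∀ {n} {A : Subset n} {j} → j ∈ A → 1 ℕ.≤ ∣ A ∣
j∈A⇒1≤∣A∣ here                            = s≤s z≤n
j∈A⇒1≤∣A∣ {A = inside  ∷ _} (there _)     = s≤s z≤n
j∈A⇒1≤∣A∣ {A = outside ∷ _} (there j∈A)   = j∈A⇒1≤∣A∣ j∈A

-- The elements of S₂ ∪ … ∪ S_N; the proofs are irrelevant, so that a state is
-- determined by the player having the move and the set of alive players.
record Nonterminal (N : ℕ) : Set where
  constructor nonterminal
  field
    mover    : Fin N
    alive    : Subset N
    .mover∈  : mover ∈ alive
    .2≤alive : 2 ℕ.≤ ∣ alive ∣

open Nonterminal public using (mover; alive)

data State (N : ℕ) : Set where
  over : (A : Subset N) → .(∣ A ∣ ≡ 1) → State N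
  turn : Nonterminal N → State N

-- L_m(s), where m is the mover of s.
targets : ∀ {N} → Nonterminal N → Subset N
targets s = alive s ∖ mover s

-- 𝐍(s).
afterMiss : ∀ {N} → Nonterminal N → Nonterminal N
afterMiss (nonterminal m A m∈A 2≤A) = nonterminal (next A m) A (next-∈ A m m∈A) 2≤A

mover-survives : ∀ {N} (A : Subset N) {m n} → m ∈ A → n ∈ A ∖ m → m ∈ A ∖ n
mover-survives A {m} m∈A n∈ = x∈p∧x≢y⇒x∈p-y m∈A λ { ≡.refl → j∉A∖j A m n∈ }

-- 𝐍ₙ(s).
afterKill : ∀ {N} (s : Nonterminal N) (n : Fin N) → .(n ∈ targets s) → State N
afterKill (nonterminal m A m∈A _) n n∈ with ∣ A ∖ n ∣ ℕ.≟ 1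
... | yes ≡1 = over (A ∖ n) ≡1
... | no  ≢1 = turn (nonterminal (next (A ∖ n) m) (A ∖ n)
                      (next-∈ (A ∖ n) m (mover-survives A m∈A n∈))
                      (ℕ.≤∧≢⇒< (j∈A⇒1≤∣A∣ (mover-survives A m∈A n∈)) (≢1 ∘ ≡.sym)))

module _ {c ℓ₁ ℓ₂} (ℝ : RealNumbers c ℓ₁ ℓ₂) where
  open RealNumbers ℝ

  record Strategy (N : ℕ) : Set (c ⊔ ℓ₁ ⊔ ℓ₂) where
    field
      x          : Nonterminal N → Fin N → Carrier
      x≥0        : ∀ s n → 0# ≤ x s n
      x-support  : ∀ s n → n ∉ targets s → x s n ≈ 0#
      x-sum      : ∀ s → ∑∈ (targets s) (λ n _ → x s n) ≈ 1#

  InUnitInterval : Carrier → Set ℓ₂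
  InUnitInterval q = (0# < q) × (q < 1#)

  duelDenominator#0 : ∀ {q r} → InUnitInterval q → InUnitInterval r →
                      q + r - q * r # 0#
  duelDenominator#0 (0<q , q<1) (0<r , _) = 0<x⇒x#0 (0<x+y-xy 0<q q<1 0<r)

  record PayoffEquations {N : ℕ} (p : Fin N → Carrier)
                         (p∈ : ∀ m → InUnitInterval (p m))
                         (σ : Strategy N) (i : Fin N)
                         (V : State N → Carrier) : Set (c ⊔ ℓ₁) where
    open Strategy σ
    field
      win       : ∀ A (one : ∣ A ∣ ≡ 1) → i ∈ A → V (over A one) ≈ 1#
      lose      : ∀ A (one : ∣ A ∣ ≡ 1) → i ∉ A → V (over A one) ≈ 0#

      duel-own  : ∀ A m (two : ∣ A ∣ ≡ 2) (i∈A : i ∈ A) → m ∈ A → i ≢ m →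
                  V (turn (nonterminal i A i∈A (ℕ.≤-reflexive (≡.sym two)))) ≈
                  p i / (p i + p m - p i * p m) [ duelDenominator#0 (p∈ i) (p∈ m) ]
      duel-opp  : ∀ A m (two : ∣ A ∣ ≡ 2) → i ∈ A → (m∈A : m ∈ A) → i ≢ m →
                  V (turn (nonterminal m A m∈A (ℕ.≤-reflexive (≡.sym two)))) ≈
                  (p i * (1# - p m)) / (p i + p m - p i * p m) [ duelDenominator#0 (p∈ i) (p∈ m) ]
      duel-dead : ∀ s → ∣ alive s ∣ ≡ 2 → i ∉ alive s → V (turn s) ≈ 0#

      step      : ∀ s → 3 ℕ.≤ ∣ alive s ∣ → i ∈ alive s →
                  V (turn s) ≈
                  (1# - p (mover s)) * V (turn (afterMiss s)) +
                  ∑∈ (targets s) (λ n n∈ → x s n * p (mover s) * V (afterKill s n n∈))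
      step-dead : ∀ s → 3 ℕ.≤ ∣ alive s ∣ → i ∉ alive s → V (turn s) ≈ 0#

{-# OPTIONS --safe #-}

-- Once the values of the states with fewer players are known, the equations of
-- the states with a given set A of alive players form a system on A in which each
-- equation is either v m ≈ c or v m ≈ (1 - p m) v (next A m) + c.  Such a system
-- has a unique solution for any successor function on a finite set and any
-- coefficients strictly between 0 and 1: eliminate one unknown (solving
-- x ≈ q x + c if it points to itself) and substitute it in the others; the
-- coefficients remain constants or products of numbers in (0, 1).  Induction on
-- the number of alive players then gives existence and uniqueness.
module Submission where

open import Defs
open import Data.Fin.Base using (Fin)
open import Data.Nat.Base as ℕ using (ℕ)
open import Data.Product using (∃!)
open import Relation.Binary.PropositionalEquality using (_≢_)
open import Relation.Nullary using (¬_)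

open import Algebra.Bundles using (CommutativeRing)
import Algebra.Properties.CommutativeMonoid.Sum as Summation
import Algebra.Properties.Group as GroupProperties
import Algebra.Properties.Ring as RingProperties
import Algebra.Solver.Ring.NaturalCoefficients.Default as SemiringSolver
open import Data.Empty using (⊥-elim-irr)
open import Data.Fin.Base using (zero; suc)
open import Data.Fin.Properties as Fin using (any?)
open import Data.Fin.Subset using (Subset; _∈_; _∉_; ∣_∣; ⁅_⁆)
  renaming (_-_ to _∖_)
open import Data.Fin.Subset.Properties
  using (_∈?_; p─q⊆p; x∈p⇒∣p-x∣<∣p∣; x∈p∧x≢y⇒x∈p-y; x∈⁅x⁆; ∣⁅x⁆∣≡1; p⊆q⇒∣p∣≤∣q∣; ∣p∣≤n)
import Data.Nat.Properties as ℕ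
open import Data.Product using (_×_; _,_; proj₁; proj₂; ∃-syntax)
open import Data.Vec.Functional using (Vector; _∷_)
open import Function.Base using (_∘_)
open import Level using (_⊔_)
open import Relation.Binary.PropositionalEquality as ≡ using (_≡_)
import Relation.Binary.Reasoning.Setoid as SetoidReasoning
open import Relation.Nullary using (Dec; yes; no; contradiction; recompute)
open import Relation.Nullary.Decidable using (_×-dec_; ¬?)

-- Counting alive players.

size : ∀ {N} → State N → ℕ
size (over A _) = ∣ A ∣
size (turn s)   = ∣ alive s ∣

size-afterKill : ∀ {N} (s : Nonterminal N) n .(n∈ : n ∈ targets s) →
                 size (afterKill s n n∈) ≡ ∣ alive s ∖ n ∣
size-afterKill s n _ with ∣ alive s ∖ n ∣ ℕ.≟ 1
... | yes _ = ≡.refl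
... | no  _ = ≡.refl

size-afterKill-< : ∀ {N} (s : Nonterminal N) n (n∈ : n ∈ targets s) →
                   size (afterKill s n n∈) ℕ.< ∣ alive s ∣
size-afterKill-< s n n∈ = ≡.subst (ℕ._< ∣ alive s ∣) (≡.sym (size-afterKill s n n∈))
  (x∈p⇒∣p-x∣<∣p∣ (p─q⊆p (alive s) ⁅ mover s ⁆ n∈))

-- Otherwise `A` would lie in the singleton of `i` and have at most one element.
opponent-exists : ∀ {n} (A : Subset n) i → ∣ A ∣ ≡ 2 → ∃[ j ] j ∈ A × i ≢ j
opponent-exists A i two with any? (λ j → j ∈? A ×-dec ¬? (i Fin.≟ j))
... | yes found = found
... | no  none  = contradiction
  (ℕ.≤-trans (ℕ.≤-reflexive (≡.sym two)) (ℕ.≤-trans (p⊆q⇒∣p∣≤∣q∣ A⊆⁅i⁆) (ℕ.≤-reflexive (∣⁅x⁆∣≡1 i))))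
  ℕ.1+n≰n
  where
  A⊆⁅i⁆ : ∀ {j} → j ∈ A → j ∈ ⁅ i ⁆
  A⊆⁅i⁆ {j} j∈A with i Fin.≟ j
  ... | yes ≡.refl = x∈⁅x⁆ i
  ... | no  i≢j    = contradiction (j , j∈A , i≢j) none

-- If `j` and `k` differed, removing `i` and then `j` would still leave `k`, so `A` would have at
-- least three elements.
opponent-unique : ∀ {n} (A : Subset n) {i j k} → ∣ A ∣ ≡ 2 → i ∈ A →
                  j ∈ A → i ≢ j → k ∈ A → i ≢ k → j ≡ k
opponent-unique A {i} {j} {k} two i∈A j∈A i≢j k∈A i≢k with j Fin.≟ k
... | yes j≡k = j≡k
... | no  j≢k = contradiction (ℕ.≤-trans 3≤∣A∣ (ℕ.≤-reflexive two)) ℕ.1+n≰n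
  where
  j∈A∖i : j ∈ A ∖ i
  j∈A∖i = x∈p∧x≢y⇒x∈p-y j∈A (i≢j ∘ ≡.sym)

  k∈A∖i∖j : k ∈ (A ∖ i) ∖ j
  k∈A∖i∖j = x∈p∧x≢y⇒x∈p-y (x∈p∧x≢y⇒x∈p-y k∈A (i≢k ∘ ≡.sym)) (j≢k ∘ ≡.sym)

  3≤∣A∣ : 3 ℕ.≤ ∣ A ∣
  3≤∣A∣ = ℕ.≤-trans
    (ℕ.s≤s (ℕ.≤-trans (ℕ.s≤s (j∈A⇒1≤∣A∣ k∈A∖i∖j)) (x∈p⇒∣p-x∣<∣p∣ j∈A∖i)))
    (x∈p⇒∣p-x∣<∣p∣ i∈A)

-- Affine systems with at most one unknown on each right-hand side.

module EdgeSystem {c ℓ₁ ℓ₂} (ℝ : RealNumbers c ℓ₁ ℓ₂) where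
  open RealNumbers ℝ hiding (zero)
  open CommutativeRing commutativeRing using (+-group; commutativeSemiring)
  open SetoidReasoning setoid
  open SemiringSolver commutativeSemiring using (solve; _:=_; _:+_; _:*_)

  -- 0 < q < 1, with 1 - q named d so that the identities below are semiring identities.
  Damped : Carrier → Set _
  Damped q = 0# < q × ∃[ d ] 0# < d × d + q ≈ 1#

  -- The witness comes from 1 - qr = (1 - q) + q(1 - r).
  Damped-* : ∀ {q r} → Damped q → Damped r → Damped (q * r)
  Damped-* {q} {r} (0<q , d , 0<d , d+q≈1) (0<r , e , 0<e , e+r≈1) =
    *-pos 0<q 0<r , d + q * e , 0<x+y 0<d (*-pos 0<q 0<e) , (begin
      (d + q * e) + q * r  ≈⟨ solve 4 (λ d q e r → (d :+ q :* e) :+ q :* r := d :+ q :* (e :+ r)) refl d q e r ⟩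
      d + q * (e + r)      ≈⟨ +-congˡ (*-congˡ e+r≈1) ⟩
      d + q * 1#           ≈⟨ +-congˡ (*-identityʳ q) ⟩
      d + q                ≈⟨ d+q≈1 ⟩
      1#                   ∎)

  -- The solution is c / (1 - q), with `r` the inverse of `d`, that is of 1 - q.
  fixedPoint : ∀ {q} → Damped q → ∀ c → ∃! _≈_ (λ x → x ≈ q * x + c)
  fixedPoint {q} (_ , d , 0<d , d+q≈1) c = r * c , solves , unique
    where
    r : Carrier
    r = proj₁ (#⇒invertible (0<x⇒x#0 0<d))

    rd≈1 : r * d ≈ 1#
    rd≈1 = begin
      r * d         ≈⟨ *-congˡ (+-identityʳ d) ⟨
      r * (d + 0#)  ≈⟨ *-congˡ (+-congˡ (RingProperties.-0#≈0# ring)) ⟨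
      r * (d - 0#)  ≈⟨ proj₁ (proj₂ (#⇒invertible (0<x⇒x#0 0<d))) ⟩
      1#            ∎

    d+q-split : ∀ x → x ≈ q * x + d * x
    d+q-split x = begin
      x              ≈⟨ *-identityˡ x ⟨
      1# * x         ≈⟨ *-congʳ d+q≈1 ⟨
      (d + q) * x    ≈⟨ solve 3 (λ d q x → (d :+ q) :* x := q :* x :+ d :* x) refl d q x ⟩
      q * x + d * x  ∎

    solves : r * c ≈ q * (r * c) + c
    solves = begin
      r * c                      ≈⟨ d+q-split (r * c) ⟩
      q * (r * c) + d * (r * c)  ≈⟨ +-congˡ (solve 3 (λ d r c → d :* (r :* c) := (r :* d) :* c) refl d r c) ⟩
      q * (r * c) + (r * d) * c  ≈⟨ +-congˡ (*-congʳ rd≈1) ⟩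
      q * (r * c) + 1# * c       ≈⟨ +-congˡ (*-identityˡ c) ⟩
      q * (r * c) + c            ∎

    unique : ∀ {y} → y ≈ q * y + c → r * c ≈ y
    unique {y} y≈ = begin
      -- Splitting `y` as `q * y + d * y` and cancelling `q * y` in its equation leaves `c ≈ d * y`.
      r * c        ≈⟨ *-congˡ (GroupProperties.∙-cancelˡ +-group (q * y) c (d * y) (trans (sym y≈) (d+q-split y))) ⟩
      r * (d * y)  ≈⟨ *-assoc r d y ⟨
      (r * d) * y  ≈⟨ *-congʳ rd≈1 ⟩
      1# * y       ≈⟨ *-identityˡ y ⟩
      y            ∎

  -- The right-hand side of an equation v m ≈ c or v m ≈ q * v j + c.
  data Edge (n : ℕ) : Set (c ⊔ ℓ₁ ⊔ ℓ₂) where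
    const : Carrier → Edge n
    via   : Fin n → ∀ q → Damped q → Carrier → Edge n

  ⟦_⟧ : ∀ {n} → Edge n → Vector Carrier n → Carrier
  ⟦ const c ⟧     v = c
  ⟦ via j q _ c ⟧ v = q * v j + c

  Solves : ∀ {n} → (Fin n → Edge n) → Vector Carrier n → Set ℓ₁
  Solves e v = ∀ m → v m ≈ ⟦ e m ⟧ v

  ⟦⟧-cong : ∀ {n} (e : Edge n) {v w} → (∀ m → v m ≈ w m) → ⟦ e ⟧ v ≈ ⟦ e ⟧ w
  ⟦⟧-cong (const _)     _   = refl
  ⟦⟧-cong (via j _ _ _) v≈w = +-congʳ (*-congˡ (v≈w j))

  -- Removes the unknown `zero` from its own equation. Of the two lemmas below, the first serves
  -- existence and the second uniqueness.
  unloop : ∀ {n} → Edge (ℕ.suc n) → Edge n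
  unloop (const c)                = const c
  unloop (via zero    q damped c) = const (proj₁ (fixedPoint damped c))
  unloop (via (suc j) q damped c) = via j q damped c

  unloop-solves : ∀ {n} (e : Edge (ℕ.suc n)) v → v zero ≈ ⟦ unloop e ⟧ (v ∘ suc) → v zero ≈ ⟦ e ⟧ v
  unloop-solves (const c)                v v₀≈ = v₀≈
  unloop-solves (via zero    q damped c) v v₀≈ =
    trans v₀≈ (trans (proj₁ (proj₂ (fixedPoint damped c))) (+-congʳ (*-congˡ (sym v₀≈))))
  unloop-solves (via (suc j) q damped c) v v₀≈ = v₀≈

  solves-unloop : ∀ {n} (e : Edge (ℕ.suc n)) v → v zero ≈ ⟦ e ⟧ v → v zero ≈ ⟦ unloop e ⟧ (v ∘ suc)
  solves-unloop (const c)                v v₀≈ = v₀≈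
  solves-unloop (via zero    q damped c) v v₀≈ = sym (proj₂ (proj₂ (fixedPoint damped c)) v₀≈)
  solves-unloop (via (suc j) q damped c) v v₀≈ = v₀≈

  -- Composing affine maps multiplies their slopes, so the result is again an edge, by `Damped-*`.
  substitute : ∀ {n} → Edge n → Edge (ℕ.suc n) → Edge n
  substitute g              (const c)                = const c
  substitute g              (via (suc j) q damped c) = via j q damped c
  substitute (const d)      (via zero q damped c)    = const (q * d + c)
  substitute (via j r dr d) (via zero q damped c)    = via j (q * r) (Damped-* damped dr) (q * d + c)

  ⟦substitute⟧ : ∀ {n} (g : Edge n) (e : Edge (ℕ.suc n)) v → v zero ≈ ⟦ g ⟧ (v ∘ suc) →
                 ⟦ substitute g e ⟧ (v ∘ suc) ≈ ⟦ e ⟧ v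
  ⟦substitute⟧ g             (const c)           v v₀≈ = refl
  ⟦substitute⟧ g             (via (suc j) q _ c) v v₀≈ = refl
  ⟦substitute⟧ (const d)     (via zero q _ c)    v v₀≈ = +-congʳ (*-congˡ (sym v₀≈))
  ⟦substitute⟧ (via j r _ d) (via zero q _ c)    v v₀≈ = begin
    (q * r) * v (suc j) + (q * d + c)  ≈⟨ solve 5 (λ q r x d c → (q :* r) :* x :+ (q :* d :+ c) := q :* (r :* x :+ d) :+ c) refl q r (v (suc j)) d c ⟩
    q * (r * v (suc j) + d) + c        ≈⟨ +-congʳ (*-congˡ v₀≈) ⟨
    q * v zero + c                     ∎

  solution : ∀ {n} (e : Fin n → Edge n) → ∃! (λ v w → ∀ m → v m ≈ w m) (Solves e)
  solution {ℕ.zero}  e = (λ ()) , (λ ()) , λ _ ()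
  solution {ℕ.suc n} e = v , solves , unique
    where
    g : Edge n
    g = unloop (e zero)

    reduced : Fin n → Edge n
    reduced m = substitute g (e (suc m))

    w : Vector Carrier n
    w = proj₁ (solution reduced)

    v : Vector Carrier (ℕ.suc n)
    -- Back substitution: `g` gives the eliminated unknown from the others.
    v = ⟦ g ⟧ w ∷ w

    solves : Solves e v
    solves zero    = unloop-solves (e zero) v refl
    solves (suc m) = trans (proj₁ (proj₂ (solution reduced)) m) (⟦substitute⟧ g (e (suc m)) v refl)

    unique : ∀ {u} → Solves e u → ∀ m → v m ≈ u m
    unique {u} u-solves = λ
      { zero    → trans (⟦⟧-cong g w≈) (sym u₀≈)
      ; (suc m) → w≈ m
      }
      where
      u₀≈ : u zero ≈ ⟦ g ⟧ (u ∘ suc)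
      u₀≈ = solves-unloop (e zero) u (u-solves zero)

      w≈ : ∀ m → w m ≈ u (suc m)
      w≈ = proj₂ (proj₂ (solution reduced)) λ m →
        trans (u-solves (suc m)) (sym (⟦substitute⟧ g (e (suc m)) u u₀≈))

-- Sums and duel values for a fixed player `i`.

module Game {c ℓ₁ ℓ₂} (ℝ : RealNumbers c ℓ₁ ℓ₂) {N : ℕ}
            (p : Fin N → RealNumbers.Carrier ℝ) (p∈ : ∀ m → InUnitInterval ℝ (p m))
            (σ : Strategy ℝ N) (i : Fin N) where
  open RealNumbers ℝ
  open Strategy σ
  open EdgeSystem ℝ
  open SetoidReasoning setoid

  Values : Set c
  Values = State N → Carrier

  valueIf-yes : ∀ {P : Set} (P? : Dec P) (g : .P → Carrier) .(h : P) →
                valueIf P? (λ h → g h) ≡ g h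
  valueIf-yes (yes _)  g h = ≡.refl
  valueIf-yes (no ¬h) g h = ⊥-elim-irr (¬h h)

  ∑∈-cong : ∀ {n} (A : Subset n) {f g : (j : Fin n) → j ∈ A → Carrier} →
            (∀ j j∈A → f j j∈A ≈ g j j∈A) → ∑∈ A f ≈ ∑∈ A g
  ∑∈-cong A {f} {g} f≈g = Summation.sum-cong-≋ +-commutativeMonoid λ j → valueIf-cong j (j ∈? A)
    where
    valueIf-cong : ∀ j (d : Dec (j ∈ A)) → valueIf d (f j) ≈ valueIf d (g j)
    valueIf-cong j (yes j∈A) = f≈g j j∈A
    valueIf-cong j (no  _)   = refl

  outcome : Subset N → Carrier
  outcome A = valueIf (i ∈? A) (λ _ → 1#)

  -- The default 0# is not reached for A of size 2.
  ownDuel : ∀ {A} → Dec (∃[ j ] j ∈ A × i ≢ j) → Carrier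
  ownDuel (yes (j , _)) = p i / (p i + p j - p i * p j) [ duelDenominator#0 ℝ (p∈ i) (p∈ j) ]
  ownDuel (no  _)       = 0#

  -- If `i` is not the mover, the opponent is the mover. If `i` moves, the state does not name the
  -- opponent, who is found by search.
  duelBy : ∀ A m → Dec (m ≡ i) → Carrier
  duelBy A m (yes _) = ownDuel {A} (any? (λ j → j ∈? A ×-dec ¬? (i Fin.≟ j)))
  duelBy A m (no  _) = (p i * (1# - p m)) / (p i + p m - p i * p m) [ duelDenominator#0 ℝ (p∈ i) (p∈ m) ]

  duel : Subset N → Fin N → Carrier
  duel A m = duelBy A m (m Fin.≟ i)

  duel-own≈ : ∀ A m → ∣ A ∣ ≡ 2 → i ∈ A → m ∈ A → i ≢ m →
              duel A i ≈ p i / (p i + p m - p i * p m) [ duelDenominator#0 ℝ (p∈ i) (p∈ m) ]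
  duel-own≈ A m two i∈A m∈A i≢m with i Fin.≟ i
  ... | no  i≢i = contradiction ≡.refl i≢i
  ... | yes _ with any? (λ j → j ∈? A ×-dec ¬? (i Fin.≟ j))
  ...   | no  none = contradiction (m , m∈A , i≢m) none
  -- The search may return another proof and another name for the opponent; uniqueness identifies it
  -- with `m`.
  ...   | yes (j , j∈A , i≢j) with ≡.refl ← opponent-unique A two i∈A j∈A i≢j m∈A i≢m = refl

  duel-opp≈ : ∀ A m → i ≢ m →
              duel A m ≈ (p i * (1# - p m)) / (p i + p m - p i * p m) [ duelDenominator#0 ℝ (p∈ i) (p∈ m) ]
  duel-opp≈ A m i≢m with m Fin.≟ i
  ... | yes m≡i = contradiction (≡.sym m≡i) i≢m
  ... | no  _   = refl

  -- The complement of the miss probability is the marksmanship `p m`.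
  1-p-damped : ∀ m → Damped (1# - p m)
  1-p-damped m with 0<p , p<1 ← p∈ m = x<y⇒0<y-x p<1 , p m , 0<p , (begin
    p m + (1# - p m)      ≈⟨ +-comm (p m) (1# - p m) ⟩
    (1# - p m) + p m      ≈⟨ +-assoc 1# (- p m) (p m) ⟩
    1# + (- p m + p m)    ≈⟨ +-congˡ (-‿inverseˡ (p m)) ⟩
    1# + 0#               ≈⟨ +-identityʳ 1# ⟩
    1#                    ∎)

  -- The payoff equations as one system for each set of alive players.

  killTerm : Values → Nonterminal N → Carrier
  killTerm V s = ∑∈ (targets s) (λ n n∈ → x s n * p (mover s) * V (afterKill s n n∈))

  edgeBy : Values → (s : Nonterminal N) → Dec (i ∈ alive s) → Dec (∣ alive s ∣ ≡ 2) → Edge N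
  edgeBy V s (no  _) _       = const 0#
  edgeBy V s (yes _) (yes _) = const (duel (alive s) (mover s))
  -- A nonterminal state has at least two alive players, so here there are at least three.
  edgeBy V s (yes _) (no  _) =
    via (next (alive s) (mover s)) (1# - p (mover s)) (1-p-damped (mover s)) (killTerm V s)

  -- The payoff equation at s, in the unknowns given by the states with the same
  -- alive players; V supplies the values of the states with fewer players.
  edge : Values → Nonterminal N → Edge N
  edge V s = edgeBy V s (i ∈? alive s) (∣ alive s ∣ ℕ.≟ 2)

  valueAt : Values → (A : Subset N) → .(2 ℕ.≤ ∣ A ∣) → (j : Fin N) → .(j ∈ A) → Carrier
  valueAt V A 2≤A j j∈A = V (turn (nonterminal j A j∈A 2≤A))

  -- `solution` works on all of `Fin N`, so players outside `A`, who have no state, are padded with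
  -- `0#`.
  row : Values → (A : Subset N) → .(2 ℕ.≤ ∣ A ∣) → Vector Carrier N
  row V A 2≤A j = valueIf (j ∈? A) (λ j∈A → valueAt V A 2≤A j j∈A)

  Agree : ℕ → Values → Values → Set ℓ₁
  Agree k V W = ∀ s → size s ℕ.< k → V s ≈ W s

  -- `V` enters an edge only through the states after a kill, which have fewer players; this makes
  -- the induction on size possible.
  edge-local : ∀ {V W} s → Agree ∣ alive s ∣ V W → ∀ {v w} → (∀ j → v j ≈ w j) →
               ⟦ edge V s ⟧ v ≈ ⟦ edge W s ⟧ w
  edge-local {V} {W} s V≈W {v} {w} v≈w with i ∈? alive s | ∣ alive s ∣ ℕ.≟ 2
  ... | no  _ | _     = refl
  ... | yes _ | yes _ = refl
  ... | yes _ | no  _ = +-cong (*-congˡ (v≈w (next (alive s) (mover s))))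
    (∑∈-cong (targets s) λ n n∈ → *-congˡ (V≈W (afterKill s n n∈) (size-afterKill-< s n n∈)))

  Holds : Values → Nonterminal N → Set ℓ₁
  Holds V s@(nonterminal _ A _ 2≤A) = V (turn s) ≈ ⟦ edge V s ⟧ (row V A 2≤A)

  Terminal : Values → Set ℓ₁
  Terminal V = ∀ A .(one : ∣ A ∣ ≡ 1) → V (over A one) ≈ outcome A

  -- The trivial equations outside `A` match the padding of `row`.
  system : Values → (A : Subset N) → .(2 ℕ.≤ ∣ A ∣) → Fin N → Edge N
  system V A 2≤A j with j ∈? A
  ... | yes j∈A = edge V (nonterminal j A j∈A 2≤A)
  ... | no  _   = const 0#

  system-alive : ∀ V A .(2≤A : 2 ℕ.≤ ∣ A ∣) j .(j∈A : j ∈ A) →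
                 system V A 2≤A j ≡ edge V (nonterminal j A j∈A 2≤A)
  system-alive V A 2≤A j j∈A with j ∈? A
  ... | yes _   = ≡.refl
  ... | no  j∉A = ⊥-elim-irr (j∉A j∈A)

  system-dead : ∀ V A .(2≤A : 2 ℕ.≤ ∣ A ∣) j → j ∉ A → system V A 2≤A j ≡ const 0#
  system-dead V A 2≤A j j∉A with j ∈? A
  ... | yes j∈A = contradiction j∈A j∉A
  ... | no  _   = ≡.refl

  row-alive : ∀ V A .(2≤A : 2 ℕ.≤ ∣ A ∣) j .(j∈A : j ∈ A) →
              row V A 2≤A j ≡ V (turn (nonterminal j A j∈A 2≤A))
  row-alive V A 2≤A j j∈A = valueIf-yes (j ∈? A) (valueAt V A 2≤A j) j∈A

  row-≈ : ∀ V A .(2≤A : 2 ℕ.≤ ∣ A ∣) (v : Vector Carrier N) →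
          (∀ j (j∈A : j ∈ A) → V (turn (nonterminal j A j∈A 2≤A)) ≈ v j) →
          (∀ j → j ∉ A → 0# ≈ v j) → ∀ j → row V A 2≤A j ≈ v j
  row-≈ V A 2≤A v alive≈ dead≈ j with j ∈? A
  ... | yes j∈A = alive≈ j j∈A
  ... | no  j∉A = dead≈ j j∉A

  row-dead : ∀ V A .(2≤A : 2 ℕ.≤ ∣ A ∣) j → j ∉ A → row V A 2≤A j ≡ 0#
  row-dead V A 2≤A j j∉A with j ∈? A
  ... | yes j∈A = contradiction j∈A j∉A
  ... | no  _   = ≡.refl

  -- Uniqueness of the values.

  -- The coefficients come from `V` and the unknowns from `W`, so two candidates that agree on
  -- smaller states have rows solving one and the same system.
  row-solves : ∀ {V W} A .(2≤A : 2 ℕ.≤ ∣ A ∣) → (∀ s → Holds W s) →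
               Agree ∣ A ∣ W V → Solves (system V A 2≤A) (row W A 2≤A)
  row-solves {V} {W} A 2≤A holds W≈V j with j ∈? A
  ... | yes j∈A = trans (holds s) (edge-local s W≈V (λ _ → refl))
    where
    s : Nonterminal N
    s = nonterminal j A j∈A 2≤A
  ... | no  _   = refl

  unique-below : ∀ {V W} → Terminal V → Terminal W → (∀ s → Holds V s) → (∀ s → Holds W s) →
                 ∀ k → Agree k V W
  unique-below {V} {W} V-over W-over V-turn W-turn (ℕ.suc k) s s<k = helper s (ℕ.s≤s⁻¹ s<k)
    where
    helper : ∀ s → size s ℕ.≤ k → V s ≈ W s
    helper (over A one) _ = trans (V-over A one) (sym (W-over A one))
    helper (turn (nonterminal m A m∈A 2≤A)) A≤k = begin
      V (turn (nonterminal m A m∈A 2≤A))  ≡⟨ row-alive V A 2≤A m m∈A ⟨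
      row V A 2≤A m                       ≈⟨ unique (row-solves A 2≤A V-turn (λ _ _ → refl)) m ⟨
      proj₁ (solution (system V A 2≤A)) m ≈⟨ unique (row-solves A 2≤A W-turn W≈V) m ⟩
      row W A 2≤A m                       ≡⟨ row-alive W A 2≤A m m∈A ⟩
      W (turn (nonterminal m A m∈A 2≤A))  ∎
      where
      unique : ∀ {v} → Solves (system V A 2≤A) v → ∀ m → proj₁ (solution (system V A 2≤A)) m ≈ v m
      unique = proj₂ (proj₂ (solution (system V A 2≤A)))

      W≈V : Agree ∣ A ∣ W V
      W≈V t t<A = sym (unique-below V-over W-over V-turn W-turn k t (ℕ.<-≤-trans t<A A≤k))

  -- Existence, by stages.

  -- Stage `k` settles the sets of size `k`. Larger sets receive provisional values, recomputed at
  -- later stages.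
  extend : ℕ → Values → Values
  extend k V (over A one) = V (over A one)
  extend k V (turn (nonterminal m A m∈A 2≤A)) with ∣ A ∣ ℕ.<? k
  ... | yes _ = V (turn (nonterminal m A m∈A 2≤A))
  ... | no  _ = proj₁ (solution (system V A 2≤A)) m

  extend-old : ∀ k V → Agree k V (extend k V)
  extend-old k V (over A one) _ = refl
  extend-old k V (turn (nonterminal m A m∈A 2≤A)) A<k with ∣ A ∣ ℕ.<? k
  ... | yes _   = refl
  ... | no  A≮k = contradiction A<k A≮k

  extend-new : ∀ k V m A .(m∈A : m ∈ A) .(2≤A : 2 ℕ.≤ ∣ A ∣) → ¬ (∣ A ∣ ℕ.< k) →
               extend k V (turn (nonterminal m A m∈A 2≤A)) ≡ proj₁ (solution (system V A 2≤A)) m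
  extend-new k V m A m∈A 2≤A A≮k with ∣ A ∣ ℕ.<? k
  ... | yes A<k = contradiction A<k A≮k
  ... | no  _   = ≡.refl

  extend-holds : ∀ k V → (∀ s → ∣ alive s ∣ ℕ.< k → Holds V s) →
                 ∀ s → ∣ alive s ∣ ℕ.< ℕ.suc k → Holds (extend k V) s
  extend-holds k V holds s@(nonterminal m A m∈A 2≤A) A<1+k = by-size (∣ A ∣ ℕ.<? k)
    where
    V′ : Values
    V′ = extend k V

    v : Vector Carrier N
    v = proj₁ (solution (system V A 2≤A))

    v-solves : Solves (system V A 2≤A) v
    v-solves = proj₁ (proj₂ (solution (system V A 2≤A)))

    V≈V′ : Agree ∣ A ∣ V V′
    V≈V′ t t<A = extend-old k V t (ℕ.<-≤-trans t<A (ℕ.s≤s⁻¹ A<1+k))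

    by-size : Dec (∣ A ∣ ℕ.< k) → Holds V′ s
    by-size (yes A<k) = begin
      V′ (turn s)                     ≈⟨ extend-old k V (turn s) A<k ⟨
      V (turn s)                      ≈⟨ holds s A<k ⟩
      ⟦ edge V s ⟧ (row V A 2≤A)      ≈⟨ edge-local s V≈V′ rows ⟩
      ⟦ edge V′ s ⟧ (row V′ A 2≤A)    ∎
      where
      rows : ∀ j → row V A 2≤A j ≈ row V′ A 2≤A j
      rows = row-≈ V A 2≤A _
        (λ j j∈A → trans (extend-old k V _ A<k) (reflexive (≡.sym (row-alive V′ A 2≤A j j∈A))))
        (λ j j∉A → reflexive (≡.sym (row-dead V′ A 2≤A j j∉A)))
    -- Here `A` has exactly `k` elements, so the states after a kill keep their values under
    -- `extend`.
    by-size (no A≮k) = begin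
      V′ (turn s)                     ≡⟨ extend-new k V m A m∈A 2≤A A≮k ⟩
      v m                             ≈⟨ v-solves m ⟩
      ⟦ system V A 2≤A m ⟧ v          ≡⟨ ≡.cong (λ e → ⟦ e ⟧ v) (system-alive V A 2≤A m m∈A) ⟩
      ⟦ edge V s ⟧ v                  ≈⟨ edge-local s V≈V′ (λ j → sym (rows j)) ⟩
      ⟦ edge V′ s ⟧ (row V′ A 2≤A)    ∎
      where
      rows : ∀ j → row V′ A 2≤A j ≈ v j
      rows = row-≈ V′ A 2≤A v
        (λ j j∈A → reflexive (extend-new k V j A j∈A 2≤A A≮k))
        -- Outside `A` the system forces `v j` to be `0#`, the padding of the row.
        (λ j j∉A → sym (trans (v-solves j)
          (reflexive (≡.cong (λ e → ⟦ e ⟧ v) (system-dead V A 2≤A j j∉A)))))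

  exists-below : ∀ k → ∃[ V ] Terminal V × (∀ s → ∣ alive s ∣ ℕ.< k → Holds V s)
  exists-below ℕ.zero    = initial , (λ _ _ → refl) , λ _ ()
    where
    initial : Values
    initial (over A _) = outcome A
    -- An arbitrary value: no size is below zero, and the first `extend` overwrites it.
    initial (turn _)   = 0#
  exists-below (ℕ.suc k) with V , V-over , V-turn ← exists-below k =
    extend k V , V-over , extend-holds k V V-turn

  -- Equivalence of the edge form and the payoff equations.

  edge-dead : ∀ V s → i ∉ alive s → edge V s ≡ const 0#
  edge-dead V s i∉A with i ∈? alive s
  ... | yes i∈A = contradiction i∈A i∉A
  ... | no  _   = ≡.refl

  edge-duel : ∀ V s → i ∈ alive s → ∣ alive s ∣ ≡ 2 → edge V s ≡ const (duel (alive s) (mover s))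
  edge-duel V s i∈A two with i ∈? alive s | ∣ alive s ∣ ℕ.≟ 2
  ... | no  i∉A | _      = contradiction i∈A i∉A
  ... | yes _   | no ≢2  = contradiction two ≢2
  ... | yes _   | yes _  = ≡.refl

  edge-step : ∀ V s → i ∈ alive s → ∣ alive s ∣ ≢ 2 →
              edge V s ≡ via (next (alive s) (mover s)) (1# - p (mover s)) (1-p-damped (mover s)) (killTerm V s)
  edge-step V s i∈A ≢2 with i ∈? alive s | ∣ alive s ∣ ℕ.≟ 2
  ... | no  i∉A | _       = contradiction i∈A i∉A
  ... | yes _   | yes two = contradiction two ≢2
  ... | yes _   | no _    = ≡.refl

  ⟦edge⟧ : ∀ V s {e} → edge V s ≡ e → ∀ {v} → ⟦ edge V s ⟧ v ≈ ⟦ e ⟧ v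
  ⟦edge⟧ V s eq {v} = reflexive (≡.cong (λ e → ⟦ e ⟧ v) eq)

  -- The next mover is alive, so the row holds a true value there and not the padding.
  row-next : ∀ V m A .(m∈A : m ∈ A) .(2≤A : 2 ℕ.≤ ∣ A ∣) →
             row V A 2≤A (next A m) ≈ V (turn (afterMiss (nonterminal m A m∈A 2≤A)))
  row-next V m A m∈A 2≤A = reflexive (row-alive V A 2≤A (next A m) (next-∈ A m m∈A))

  satisfies : ∀ {V} → Terminal V → (∀ s → Holds V s) → PayoffEquations ℝ p p∈ σ i V
  satisfies {V} V-over V-turn = record
    { win       = λ A one i∈A → trans (V-over A one) (won A i∈A)
    ; lose      = λ A one i∉A → trans (V-over A one) (lost A i∉A)
    ; duel-own  = λ A m two i∈A m∈A i≢m →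
        trans (duelling A i two i∈A i∈A) (duel-own≈ A m two i∈A m∈A i≢m)
    ; duel-opp  = λ A m two i∈A m∈A i≢m →
        trans (duelling A m two i∈A m∈A) (duel-opp≈ A m i≢m)
    ; duel-dead = λ s _ i∉A → trans (V-turn s) (⟦edge⟧ V s (edge-dead V s i∉A))
    ; step      = λ { s@(nonterminal m A m∈A 2≤A) 3≤A i∈A → trans (V-turn s)
        (trans (⟦edge⟧ V s (edge-step V s i∈A (ℕ.>⇒≢ 3≤A)))
               (+-congʳ (*-congˡ (row-next V m A m∈A 2≤A)))) }
    ; step-dead = λ s _ i∉A → trans (V-turn s) (⟦edge⟧ V s (edge-dead V s i∉A))
    }
    where
    duelling : ∀ A m (two : ∣ A ∣ ≡ 2) → i ∈ A → (m∈A : m ∈ A) →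
               V (turn (nonterminal m A m∈A (ℕ.≤-reflexive (≡.sym two)))) ≈ duel A m
    duelling A m two i∈A m∈A = trans (V-turn s) (⟦edge⟧ V s (edge-duel V s i∈A two))
      where
      s : Nonterminal N
      s = nonterminal m A m∈A (ℕ.≤-reflexive (≡.sym two))

    won : ∀ A → i ∈ A → outcome A ≈ 1#
    won A i∈A = reflexive (valueIf-yes (i ∈? A) (λ _ → 1#) i∈A)

    lost : ∀ A → i ∉ A → outcome A ≈ 0#
    lost A i∉A with i ∈? A
    ... | yes i∈A = contradiction i∈A i∉A
    ... | no  _   = refl

  module _ {V} (equations : PayoffEquations ℝ p p∈ σ i V) where
    open PayoffEquations equations

    terminal : Terminal V
    terminal A one with i ∈? A
    -- `Terminal` takes an irrelevant proof but `win` wants a relevant one, which decidability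
    -- recovers.
    ... | yes i∈A = win  A (recompute (∣ A ∣ ℕ.≟ 1) one) i∈A
    ... | no  i∉A = lose A (recompute (∣ A ∣ ℕ.≟ 1) one) i∉A

    turn≈ : ∀ s {e} → edge V s ≡ e → ∀ {v} → V (turn s) ≈ ⟦ e ⟧ v → V (turn s) ≈ ⟦ edge V s ⟧ v
    turn≈ s eq V≈ = trans V≈ (sym (⟦edge⟧ V s eq))

    duel-holds : ∀ A m .(m∈A : m ∈ A) .(2≤A : 2 ℕ.≤ ∣ A ∣) → i ∈ A → ∣ A ∣ ≡ 2 →
                 V (turn (nonterminal m A m∈A 2≤A)) ≈ duel A m
    duel-holds A m m∈A 2≤A i∈A two with m Fin.≟ i
    ... | no  m≢i = duel-opp A m two i∈A (recompute (m ∈? A) m∈A) (m≢i ∘ ≡.sym)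
    ... | yes ≡.refl with any? (λ j → j ∈? A ×-dec ¬? (i Fin.≟ j))
    -- The opponent found by the search inside `duel` is the one handed to `duel-own`.
    ...   | yes (j , j∈A , i≢j) = duel-own A j two i∈A j∈A i≢j
    ...   | no  none            = contradiction (opponent-exists A i two) none

    turn-holds : ∀ s → Holds V s
    turn-holds s@(nonterminal m A m∈A 2≤A) = by-cases (i ∈? A) (∣ A ∣ ℕ.≟ 2)
      where
      3≤A : ∣ A ∣ ≢ 2 → 3 ℕ.≤ ∣ A ∣
      3≤A ≢2 = ℕ.≤∧≢⇒< (recompute (2 ℕ.≤? ∣ A ∣) 2≤A) (≢2 ∘ ≡.sym)

      by-cases : Dec (i ∈ A) → Dec (∣ A ∣ ≡ 2) → Holds V s
      by-cases (no i∉A)  (yes two) = turn≈ s (edge-dead V s i∉A) (duel-dead s two i∉A)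
      by-cases (no i∉A)  (no ≢2)   = turn≈ s (edge-dead V s i∉A) (step-dead s (3≤A ≢2) i∉A)
      by-cases (yes i∈A) (yes two) =
        turn≈ s (edge-duel V s i∈A two) (duel-holds A m m∈A 2≤A i∈A two)
      by-cases (yes i∈A) (no ≢2)   = turn≈ s (edge-step V s i∈A ≢2)
        (trans (step s (3≤A ≢2) i∈A) (+-congʳ (*-congˡ (sym (row-next V m A m∈A 2≤A)))))

proposition3p2 : ∀ {c ℓ₁ ℓ₂} (ℝ : RealNumbers c ℓ₁ ℓ₂) → let open RealNumbers ℝ in
    (N : ℕ) → 2 ℕ.≤ N →
    (p : Fin N → Carrier) (p∈ : ∀ m → InUnitInterval ℝ (p m)) →
    (∀ m n → m ≢ n → ¬ (p m ≈ p n)) →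
    (σ : Strategy ℝ N) →
    ∀ i → ∃! (λ V W → ∀ s → V s ≈ W s) (PayoffEquations ℝ p p∈ σ i)
proposition3p2 ℝ N _ p p∈ _ σ i =
  V , satisfies V-over V-turn , λ W-equations s →
    -- The comparison in `Agree` is strict, so the bound `suc (size s)` is needed to cover `s`
    -- itself.
    unique-below V-over (terminal W-equations) V-turn (turn-holds W-equations) (ℕ.suc (size s)) s ℕ.≤-refl
  where
  open Game ℝ p p∈ σ i

  below : ∃[ V ] Terminal V × (∀ s → ∣ alive s ∣ ℕ.< ℕ.suc N → Holds V s)
  -- An alive set has at most `N` elements and the bound is strict, hence `suc N`.
  below = exists-below (ℕ.suc N)

  V : Values
  V = proj₁ below

  V-over : Terminal V
  V-over = proj₁ (proj₂ below)

  V-turn : ∀ s → Holds V s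
  V-turn s = proj₂ (proj₂ below) s (ℕ.s≤s (∣p∣≤n (alive s)))
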